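{- Let $t$ be a positive integer. The class of $K_{1,t}$-free graphs is polynomially $\chi_s$-bounded. Precisely, the $K_{1,t}$-free graphs $G$ satisfy \[\chi_s(G)=O\bigl(\omega(G)^{\frac{3(t-1)}{2}}\bigr),\] i.e. there is a constant $c_t$ depending only on $t$ such that every (non-empty) $K_{1,t}$-free graph $G$ satisfies $\chi_s(G)\leq c_t\,\omega(G)^{3(t-1)/2}$.
   Context: All graphs are finite, simple and undirected. A graph is $K_{1,t}$-free if it does not contain the star $K_{1,t}$ as an induced subgraph. The star chromatic number $\chi_s(G)$ is the minimum number of colors in a proper coloring of $G$ such that the union of any two color classes induces a star forest. $\omega(G)$ is the clique number of $G$. A hereditary class is polynomially $\chi_s$-bounded if $\chi_s(G)\le f(\omega(G))$ for all $G$ in the class, for some polynomially bounded function $f$. -}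

module Defs where

open import Data.Fin using (Fin; zero; suc)
open import Data.Fin.Properties as Fin using (any?; all?; injective⇒≤)
open import Data.Irrelevant using ([_])
open import Data.Nat using (ℕ; zero; suc; _+_; _*_; _^_; _≤_; z≤n; s≤s)
open import Data.Nat.Properties using (≤-pred; ≤∧≢⇒<)
open import Data.Product using (∃; ∃₂; Σ; _×_; _,_; proj₁; proj₂)
open import Data.Refinement as Refinement using (Refinement-syntax; value; value-injective; _,_)
open import Data.Sum as Sum using (_⊎_; inj₁; inj₂)
open import Function using (_∘_; id)
open import Function.Bundles using (_⇔_; mk⇔; Equivalence)
open import Function.Definitions using (Injective)
open import Level using (0ℓ)
open import Relation.Binary using (Rel; Irreflexive; Symmetric; DecidableEquality)
  renaming (Decidable to Decidable₂)
open import Relation.Binary.Construct.Closure.ReflexiveTransitive using (Star; ε; _◅_)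
open import Relation.Binary.PropositionalEquality
  using (_≡_; _≢_; _≗_; refl; sym; cong; subst; subst₂; ≢-sym)
open import Relation.Nullary using (¬_; Dec; yes; no; contradiction)
open import Relation.Nullary.Decidable
  using (map′; _×-dec_; _⊎-dec_; _→-dec_; ¬?; decidable-stable; recompute)
open import Relation.Unary using (Pred; Decidable)

private
  variable
    V W X : Set
    k m n : ℕ

record Graph (V : Set) : Set₁ where
  infix 4 _~_ _~?_
  field
    _~_      : Rel V 0ℓ
    ~-sym    : Symmetric _~_
    ~-irrefl : Irreflexive _≡_ _~_
    _~?_     : Decidable₂ _~_

  Reachable : Rel V 0ℓ
  Reachable = Star _~_

-- H ↪ G: an induced subgraph of G isomorphic to H.
infix 4 _↪_
record _↪_ (H : Graph W) (G : Graph V) : Set where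
  private
    module H = Graph H
    module G = Graph G
  field
    to        : W → V
    injective : Injective _≡_ _≡_ to
    adjacency : ∀ {x y} → x H.~ y ⇔ to x G.~ to y

↪-trans : {F : Graph X} {H : Graph W} {G : Graph V} → F ↪ H → H ↪ G → F ↪ G
↪-trans f g = record
  { to        = g.to ∘ f.to
  ; injective = f.injective ∘ g.injective
  ; adjacency = mk⇔ (Equivalence.to g.adjacency ∘ Equivalence.to f.adjacency)
                    (Equivalence.from f.adjacency ∘ Equivalence.from g.adjacency)
  }
  where
  module f = _↪_ f
  module g = _↪_ g

-- Membership in the refinement type is proof-irrelevant, so each vertex
-- satisfying P occurs exactly once.
induced : Graph V → (P : Pred V 0ℓ) → Graph [ v ∈ V ∣ P v ]
induced G P = record
  { _~_      = λ u v → value u ~ value v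
  ; ~-sym    = ~-sym
  ; ~-irrefl = λ u≡v → ~-irrefl (cong value u≡v)
  ; _~?_     = λ u v → value u ~? value v
  }
  where open Graph G

complete : ∀ k → Graph (Fin k)
complete k = record
  { _~_      = _≢_
  ; ~-sym    = ≢-sym
  ; ~-irrefl = λ u≡v u≢v → u≢v u≡v
  ; _~?_     = λ u v → ¬? (u Fin.≟ v)
  }

data StarAdj {t : ℕ} : Rel (Fin (suc t)) 0ℓ where
  centre-leaf : ∀ {i} → StarAdj zero (suc i)
  leaf-centre : ∀ {i} → StarAdj (suc i) zero

-- K_{1,t}
star : ∀ t → Graph (Fin (suc t))
star t = record
  { _~_      = StarAdj
  ; ~-sym    = λ { centre-leaf → leaf-centre ; leaf-centre → centre-leaf }
  ; ~-irrefl = λ { refl () }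
  ; _~?_     = λ { zero zero → no λ () ; zero (suc _) → yes centre-leaf
                 ; (suc _) zero → yes leaf-centre ; (suc _) (suc _) → no λ () }
  }

-- The connected component of v is a star K_{1,m} for some m ≥ 0
-- (an isolated vertex is the star with m = 0).
record StarComponent (G : Graph V) (v : V) : Set where
  open Graph G
  field
    centre   : V
    reaches  : Reachable v centre
    spokes   : ∀ {u} → Reachable v u → u ≢ centre → centre ~ u
    no-other : ∀ {u w} → Reachable v u → Reachable v w → u ~ w →
               u ≡ centre ⊎ w ≡ centre

IsStarForest : Graph V → Set
IsStarForest G = ∀ v → StarComponent G v

record IsStarColouring (G : Graph V) (colour : V → Fin k) : Set where
  open Graph G
  field
    proper     : ∀ {u v} → u ~ v → colour u ≢ colour v
    starForest : ∀ {i j} → i ≢ j →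
                 IsStarForest (induced G λ v → colour v ≡ i ⊎ colour v ≡ j)

StarColourable : Graph V → ℕ → Set
StarColourable {V} G k = Σ (V → Fin k) (IsStarColouring G)

IsStarChromaticNumber : Graph V → ℕ → Set
IsStarChromaticNumber G k = StarColourable G k × (∀ {m} → StarColourable G m → k ≤ m)

IsCliqueNumber : Graph V → ℕ → Set
IsCliqueNumber G k = complete k ↪ G × (∀ {m} → complete m ↪ G → m ≤ k)

-- Both invariants exist, constructively, for graphs on Fin n: star
-- colourability and the existence of cliques are decided by exhaustive search.
module ExhaustiveSearch where

  Searchable : Set → Set₁
  Searchable V = ∀ {P : Pred V 0ℓ} → Decidable P → Dec (∃ P)

  search-all : Searchable V → {P : Pred V 0ℓ} → Decidable P → Dec (∀ v → P v)
  search-all search P? with search (¬? ∘ P?)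
  ... | yes (v , ¬pv) = no λ p → ¬pv (p v)
  ... | no ¬∃         = yes λ v → decidable-stable (P? v) λ ¬pv → ¬∃ (v , ¬pv)

  search-refinement : {Q : Pred V 0ℓ} → Decidable Q → Searchable V →
                      Searchable [ v ∈ V ∣ Q v ]
  search-refinement {Q = Q} Q? search {P} P? =
    map′ (λ (v , q , p) → (v , [ q ]) , p)
         (λ ((v , [ q ]) , p) → v , recompute (Q? v) q , p)
         (search Q∧P?)
    where
    Q∧P? : Decidable (λ v → Σ (Q v) λ q → P (v , [ q ]))
    Q∧P? v with Q? v
    ... | no ¬q = no (¬q ∘ proj₁)
    ... | yes q = map′ (q ,_) proj₂ (P? (v , [ q ]))

  cons : V → (Fin n → V) → Fin (suc n) → V
  cons x f zero    = x
  cons x f (suc i) = f i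

  search-function : Searchable V → ∀ n {P : Pred (Fin n → V) 0ℓ} →
                    (∀ {f g} → f ≗ g → P f → P g) → Decidable P → Dec (∃ P)
  search-function search zero resp P? =
    map′ (_ ,_) (λ (_ , p) → resp (λ ()) p) (P? λ ())
  search-function search (suc n) resp P? =
    map′ (λ (x , f , p) → cons x f , p)
         (λ (f , p) → f zero , f ∘ suc , resp (λ { zero → refl ; (suc _) → refl }) p)
         (search λ x → search-function search n
           (λ f≗g → resp λ { zero → refl ; (suc i) → f≗g i }) (P? ∘ cons x))

  module Components (G : Graph V) where
    open Graph G

    -- Every edge at a neighbour of c leads back to c.
    Centre : V → V → Set
    Centre v c = (v ≡ c ⊎ v ~ c) × (∀ u → c ~ u → ∀ w → u ~ w → w ≡ c)

    component : ∀ {v c} → Centre v c → StarComponent G v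
    component {v} {c} (v-c , back) = record
      { centre   = c
      ; reaches  = reaches v-c
      ; spokes   = λ r u≢c → spoke u≢c (local start r)
      ; no-other = λ r _ e → other (local start r) e
      }
      where
      reaches : v ≡ c ⊎ v ~ c → Reachable v c
      reaches (inj₁ refl) = ε
      reaches (inj₂ e)    = e ◅ ε

      Local : V → Set
      Local u = u ≡ c ⊎ c ~ u

      start : Local v
      start = Sum.map₂ ~-sym v-c

      local : ∀ {u w} → Local u → Reachable u w → Local w
      local l           ε       = l
      local (inj₁ refl) (e ◅ r) = local (inj₂ e) r
      local (inj₂ c~u)  (e ◅ r) = local (inj₁ (back _ c~u _ e)) r

      spoke : ∀ {u} → u ≢ c → Local u → c ~ u
      spoke u≢c (inj₁ u≡c) = contradiction u≡c u≢c
      spoke u≢c (inj₂ e)   = e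

      other : ∀ {u w} → Local u → u ~ w → u ≡ c ⊎ w ≡ c
      other (inj₁ u≡c) _ = inj₁ u≡c
      other (inj₂ c~u) e = inj₂ (back _ c~u _ e)

    module _ (_≟_ : DecidableEquality V) (search : Searchable V) where

      Centre? : ∀ v → Decidable (Centre v)
      Centre? v c = (v ≟ c ⊎-dec v ~? c) ×-dec
        search-all search λ u → c ~? u →-dec
        search-all search λ w → u ~? w →-dec (w ≟ c)

      centred : ∀ {v} → StarComponent G v → ∃ (Centre v)
      centred {v} s = centre , v-c (v ≟ centre) , λ u c~u w u~w → back c~u u~w
        where
        open StarComponent s

        v-c : Dec (v ≡ centre) → v ≡ centre ⊎ v ~ centre
        v-c (yes v≡c) = inj₁ v≡c
        v-c (no v≢c)  = inj₂ (~-sym (spokes ε v≢c))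

        _▻_ : ∀ {x y z} → Reachable x y → y ~ z → Reachable x z
        ε       ▻ e = e ◅ ε
        (f ◅ r) ▻ e = f ◅ (r ▻ e)

        back : ∀ {u w} → centre ~ u → u ~ w → w ≡ centre
        back c~u u~w with no-other (reaches ▻ c~u) ((reaches ▻ c~u) ▻ u~w) u~w
        ... | inj₁ u≡c = contradiction c~u (~-irrefl (sym u≡c))
        ... | inj₂ w≡c = w≡c

      isStarForest? : Dec (IsStarForest G)
      isStarForest? = search-all search λ v →
        map′ (component ∘ proj₂) centred (search (Centre? v))

  module _ (G : Graph (Fin n)) where
    open Graph G

    TwoClasses : (Fin n → Fin k) → Fin k → Fin k → Pred (Fin n) 0ℓ
    TwoClasses f i j v = f v ≡ i ⊎ f v ≡ j

    search-classes : (f : Fin n → Fin k) → ∀ i j → Searchable [ v ∈ Fin n ∣ TwoClasses f i j v ]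
    search-classes f i j = search-refinement (λ v → (f v Fin.≟ i) ⊎-dec (f v Fin.≟ j)) any?

    isStarColouring? : (f : Fin n → Fin k) → Dec (IsStarColouring G f)
    isStarColouring? f =
      map′ (λ (p , s) → record { proper = p _ _ ; starForest = s _ _ })
           (λ s → (λ _ _ → IsStarColouring.proper s) , (λ _ _ → IsStarColouring.starForest s))
           ((all? λ u → all? λ v → u ~? v →-dec ¬? (f u Fin.≟ f v)) ×-dec
            (all? λ i → all? λ j → ¬? (i Fin.≟ j) →-dec
              Components.isStarForest? (induced G (TwoClasses f i j)) (Refinement._≟_ Fin._≟_) (search-classes f i j)))

    resp : {f g : Fin n → Fin k} → f ≗ g → IsStarColouring G f → IsStarColouring G g
    resp {k} {f} {g} f≗g s = record
      { proper     = λ {u} {v} e → subst₂ _≢_ (f≗g u) (f≗g v) (IsStarColouring.proper s e)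
      ; starForest = λ i≢j v →
          let _ , v-c , back-to-c = Components.centred (induced G _) (Refinement._≟_ Fin._≟_) (search-classes f _ _)
                                      (IsStarColouring.starForest s i≢j (pull v))
          in Components.component (induced G _)
               (push-centre v-c , λ u e w e′ → cong push (back-to-c (pull u) e (pull w) e′))
      }
      where
      push : ∀ {i j} → [ v ∈ Fin n ∣ TwoClasses f i j v ] → [ v ∈ Fin n ∣ TwoClasses g i j v ]
      push {i} {j} (v , [ p ]) = v , [ subst (λ x → x ≡ i ⊎ x ≡ j) (f≗g v) p ]

      pull : ∀ {i j} → [ v ∈ Fin n ∣ TwoClasses g i j v ] → [ v ∈ Fin n ∣ TwoClasses f i j v ]
      pull {i} {j} (v , [ p ]) = v , [ subst (λ x → x ≡ i ⊎ x ≡ j) (sym (f≗g v)) p ]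

      push-centre : ∀ {i j} {v : [ v ∈ Fin n ∣ TwoClasses g i j v ]} {c} →
                    pull v ≡ c ⊎ value v ~ value c → v ≡ push c ⊎ value v ~ value c
      push-centre = Sum.map₁ (cong push)

    starColourable? : Decidable (StarColourable G)
    starColourable? k = search-function any? n resp isStarColouring?

    rainbow : StarColourable G n
    rainbow = id , record
      { proper     = λ e u≡v → ~-irrefl u≡v e
      ; starForest = λ {i} {j} _ v → Components.component (induced G _) {c = v}
          (inj₁ refl , λ u c~u w u~w → value-injective (back v u w c~u u~w))
      }
      where
      two : ∀ {i j} {a b c : Fin n} → a ≡ i ⊎ a ≡ j → b ≡ i ⊎ b ≡ j → c ≡ i ⊎ c ≡ j →
            a ≢ b → b ≢ c → c ≡ a
      two (inj₁ refl) (inj₁ refl) _           a≢b _   = contradiction refl a≢b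
      two (inj₁ refl) (inj₂ refl) (inj₁ refl) _   _   = refl
      two (inj₁ refl) (inj₂ refl) (inj₂ refl) _   b≢c = contradiction refl b≢c
      two (inj₂ refl) (inj₁ refl) (inj₁ refl) _   b≢c = contradiction refl b≢c
      two (inj₂ refl) (inj₁ refl) (inj₂ refl) _   _   = refl
      two (inj₂ refl) (inj₂ refl) _           a≢b _   = contradiction refl a≢b

      back : ∀ {i j} (v u w : [ x ∈ Fin n ∣ TwoClasses id i j x ]) →
             value v ~ value u → value u ~ value w → value w ≡ value v
      back (v , [ p ]) (u , [ q ]) (w , [ r ]) v~u u~w =
        recompute (w Fin.≟ v)
          (two p q r (λ eq → ~-irrefl eq v~u) (λ eq → ~-irrefl eq u~w))

    clique? : ∀ k → Dec (complete k ↪ G)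
    clique? k = map′ clique (λ c → _↪_.to c , pairwise c)
      (search-function any? k resp′ λ f → all? λ x → all? λ y →
        ¬? (x Fin.≟ y) →-dec (f x ~? f y))
      where
      Pairwise : Pred (Fin k → Fin n) 0ℓ
      Pairwise f = ∀ x y → x ≢ y → f x ~ f y

      resp′ : ∀ {f g} → f ≗ g → Pairwise f → Pairwise g
      resp′ f≗g p x y x≢y = subst₂ _~_ (f≗g x) (f≗g y) (p x y x≢y)

      pairwise : (c : complete k ↪ G) → Pairwise (_↪_.to c)
      pairwise c _ _ = Equivalence.to (_↪_.adjacency c)

      clique : ∃ Pairwise → complete k ↪ G
      clique (f , p) = record
        { to        = f
        ; injective = λ {x} {y} eq → decidable-stable (x Fin.≟ y) λ x≢y → ~-irrefl eq (p x y x≢y)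
        ; adjacency = mk⇔ (p _ _) λ e x≡y → ~-irrefl (cong f x≡y) e
        }

  least : {P : Pred ℕ 0ℓ} → Decidable P → ∀ n → P n → ∃ λ k → P k × (∀ {m} → P m → k ≤ m)
  least P? zero    p = zero , p , λ _ → z≤n
  least {P} P? (suc n) p with P? zero
  ... | yes p₀ = zero , p₀ , λ _ → z≤n
  ... | no ¬p₀ with least {P ∘ suc} (P? ∘ suc) n p
  ...   | k , pk , min = suc k , pk , λ { {zero} p₀ → contradiction p₀ ¬p₀ ; {suc m} pm → s≤s (min pm) }

  greatest : {P : Pred ℕ 0ℓ} → Decidable P → P 0 → ∀ n → (∀ {m} → P m → m ≤ n) →
             ∃ λ k → P k × (∀ {m} → P m → m ≤ k)
  greatest P? p₀ zero    bound = zero , p₀ , bound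
  greatest {P} P? p₀ (suc n) bound with P? (suc n)
  ... | yes p = suc n , p , bound
  ... | no ¬p = greatest P? p₀ n λ pm → ≤-pred (≤∧≢⇒< (bound pm) λ { refl → ¬p pm })

open ExhaustiveSearch

starChromaticNumber : (G : Graph (Fin n)) → ∃ (IsStarChromaticNumber G)
starChromaticNumber {n} G = least (starColourable? G) n (rainbow G)

cliqueNumber : (G : Graph (Fin n)) → ∃ (IsCliqueNumber G)
cliqueNumber {n} G = greatest (clique? G) empty n λ c → injective⇒≤ (_↪_.injective c)
  where
  empty : complete 0 ↪ G
  empty = record { to = λ () ; injective = λ { {()} } ; adjacency = λ { {()} } }

χₛ : Graph (Fin n) → ℕ
χₛ = proj₁ ∘ starChromaticNumber

ω : Graph (Fin n) → ℕ
ω = proj₁ ∘ cliqueNumber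

record HereditaryClass : Set₁ where
  field
    Member     : Graph (Fin n) → Set
    hereditary : {H : Graph (Fin m)} {G : Graph (Fin n)} → H ↪ G → Member G → Member H

StarFree : ℕ → HereditaryClass
StarFree t = record
  { Member     = λ G → ¬ (star t ↪ G)
  ; hereditary = λ H↪G free S↪H → free (↪-trans S↪H H↪G)
  }

-- Every polynomial is at most c * x ^ d + c on ℕ, for some c and d.
PolynomiallyBounded : (ℕ → ℕ) → Set
PolynomiallyBounded f = ∃₂ λ c d → ∀ x → f x ≤ c * x ^ d + c

PolynomiallyχₛBounded : HereditaryClass → Set₁
PolynomiallyχₛBounded C =
  Σ (ℕ → ℕ) λ f → PolynomiallyBounded f ×
    (∀ {n} (G : Graph (Fin n)) → Member G → χₛ G ≤ f (ω G))
  where open HereditaryClass C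

{-# OPTIONS --safe #-}

-- By Ramsey's theorem the neighbourhood of a vertex, having no independent set of size t and no
-- clique of size ω, has fewer than D = ω^(t-1) vertices. It remains to star-colour a graph of maximum
-- degree at most D with 4s colours, where s is about D^(3/2).
--
-- This is Rosenfeld's counting argument. Let N S count the maps from all the vertices to the 4s colours
-- that are star colourings on S. Then N (S - v) ≤ 4 N S for v ∈ S, by induction on S, so that N ⊤ > 0.
-- Indeed, a map counted by N (S - v) but not by N S either gives v the colour of a neighbour (for each
-- of the ≤ D neighbours this is a fraction 1/(4s) of N (S - v)), or makes a walk through v bicoloured.
-- For each of the ≤ 2D³ walks, the colour of v and of another vertex a on it are determined by the
-- rest, so such maps are at most N (S - v - a) / (4s)² ≤ 4 N (S - v) / (4s)² many. Altogether these
-- are at most 3/4 of N (S - v).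

module Submission where

open import Defs
open import Data.Fin using (Fin)
open import Data.Nat using (ℕ; _*_; _∸_; _^_; _≤_; NonZero)
open import Data.Product using (Σ; _×_)

open import Data.Fin using (zero; suc; fromℕ<)
open import Data.Fin.Properties as Fin using (any?; all?; injective⇒≤)
open import Data.Fin.Subset using (Subset; ⊤; _-_; _⊂_) renaming (_∈_ to _∈ₛ_; _∉_ to _∉ₛ_)
open import Data.Fin.Subset.Induction using (⊂-wellFounded; Acc; acc)
open import Data.Fin.Subset.Properties using (_∈?_; nonempty?; ∈⊤; p─q⊆p; x∈p∧x≢y⇒x∈p-y; x∈p⇒p-x⊂p)
open import Data.Irrelevant using ([_])
open import Data.List.Base
  using (List; []; _∷_; _++_; length; map; filter; lookup; allFin; concatMap; cartesianProduct; cartesianProductWith)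
open import Data.List.Membership.Propositional using (_∈_; lose)
open import Data.List.Membership.Propositional.Properties
  using ( ∈-lookup; ∈-length; ∈-filter⁺; ∈-filter⁻; ∈-allFin; ∈-map⁺; ∈-++⁺ˡ; ∈-++⁺ʳ; ∈-concatMap⁺
        ; ∈-cartesianProduct⁻; ∈-cartesianProductWith⁺ )
open import Data.List.Properties using (length-map; length-++; length-tabulate; length-filter)
open import Data.List.Relation.Binary.Sublist.Propositional using ([]; _∷ʳ_; minimum; ⊆-trans)
  renaming (_⊆_ to _⊑_; _∷_ to _⊑∷_)
open import Data.List.Relation.Binary.Sublist.Propositional.Properties using (filter-⊆; All-resp-⊆)
open import Data.List.Relation.Unary.All as All using (All; []; _∷_)
open import Data.List.Relation.Unary.All.Properties using (all-filter)
open import Data.List.Relation.Unary.AllPairs using (AllPairs; []; _∷_)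
open import Data.List.Relation.Unary.Any using (here; there; index)
open import Data.List.Relation.Unary.Any.Properties using (lookup-index)
open import Data.List.Relation.Unary.Unique.Propositional using (Unique)
open import Data.List.Relation.Unary.Unique.Propositional.Properties
  using (cartesianProductWith⁺; allFin⁺; filter⁺)
open import Data.Nat using (zero; suc; _+_; _<_; z≤n; s≤s; >-nonZero; >-nonZero⁻¹)
open import Data.Nat.Properties
open import Data.Nat.Solver using (module +-*-Solver)
open import Data.Product using (∃; _,_; proj₂)
open import Data.Refinement using (value-injective; _,_)
open import Data.Sum as Sum using (_⊎_; inj₁; inj₂)
open import Data.Vec.Base as Vec using (Vec; []; _∷_; _[_]≔_; replicate) renaming (lookup to _!_)
open import Data.Vec.Properties using ([]≔-idempotent; []≔-lookup; lookup∘update; lookup∘update′; ∷-injective)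
open import Function using (_∘_; id)
open import Function.Bundles using (mk⇔)
open import Level using (0ℓ)
open import Relation.Binary using (Rel; Symmetric) renaming (Decidable to Decidable₂)
open import Relation.Binary.PropositionalEquality
open import Relation.Nullary using (¬_; yes; no; contradiction)
open import Relation.Nullary.Decidable
  using (¬?; decidable-stable; recompute; _×-dec_; _⊎-dec_; _→-dec_)
open import Relation.Unary using (Pred; Decidable; _⊆_)
open import Relation.Unary.Properties using (_∩?_; ∁?)

private
  variable
    A W : Set
    k m n : ℕ

-- Lists: pairwise relations and lengths of duplicate-free lists.

AllPairs-resp-⊑ : {A : Set} {R : Rel A 0ℓ} {xs ys : List A} → xs ⊑ ys → AllPairs R ys → AllPairs R xs
AllPairs-resp-⊑ []            []         = []
AllPairs-resp-⊑ (_ ∷ʳ p)      (_ ∷ rs)   = AllPairs-resp-⊑ p rs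
AllPairs-resp-⊑ (refl ⊑∷ p)   (r ∷ rs)   = All-resp-⊆ p r ∷ AllPairs-resp-⊑ p rs

AllPairs-lookup : {R : Rel A 0ℓ} → Symmetric R → {xs : List A} → AllPairs R xs →
                  ∀ {i j} → i ≢ j → R (lookup xs i) (lookup xs j)
AllPairs-lookup R-sym (px ∷ pxs) {zero}  {zero}  i≢j = contradiction refl i≢j
AllPairs-lookup R-sym (px ∷ pxs) {zero}  {suc j} i≢j = All.lookup px (∈-lookup j)
AllPairs-lookup R-sym (px ∷ pxs) {suc i} {zero}  i≢j = R-sym (All.lookup px (∈-lookup i))
AllPairs-lookup R-sym (px ∷ pxs) {suc i} {suc j} i≢j = AllPairs-lookup R-sym pxs (i≢j ∘ cong suc)

-- Sending a position in `xs` to a position of the same element in `ys` is injective, because `xs`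
-- has no repetitions.
Unique∧⊆⇒length≤ : {xs ys : List A} → Unique xs → (∀ {x} → x ∈ xs → x ∈ ys) → length xs ≤ length ys
Unique∧⊆⇒length≤ {xs = xs} {ys} unique sub = injective⇒≤ {f = position} injective
  where
  position : Fin (length xs) → Fin (length ys)
  position i = index (sub (∈-lookup i))

  injective : ∀ {i j} → position i ≡ position j → i ≡ j
  injective {i} {j} eq = decidable-stable (i Fin.≟ j) λ i≢j → AllPairs-lookup ≢-sym unique i≢j
    (trans (lookup-index (sub (∈-lookup i)))
      (trans (cong (lookup ys) eq) (sym (lookup-index (sub (∈-lookup j))))))

-- Counting the elements of a list that satisfy a decidable predicate.

count : {P : Pred A 0ℓ} → Decidable P → List A → ℕ
count P? xs = length (filter P? xs)

count-mono : {P Q : Pred A 0ℓ} (P? : Decidable P) (Q? : Decidable Q) → P ⊆ Q → ∀ xs → count P? xs ≤ count Q? xs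
count-mono P? Q? P⊆Q [] = z≤n
count-mono P? Q? P⊆Q (x ∷ xs) with P? x | Q? x
... | yes p | yes q = s≤s (count-mono P? Q? P⊆Q xs)
... | yes p | no ¬q = contradiction (P⊆Q p) ¬q
... | no ¬p | yes q = m≤n⇒m≤1+n (count-mono P? Q? P⊆Q xs)
... | no ¬p | no ¬q = count-mono P? Q? P⊆Q xs

count-split : {P Q : Pred A 0ℓ} (P? : Decidable P) (Q? : Decidable Q) → ∀ xs →
              count P? xs ≡ count (P? ∩? Q?) xs + count (P? ∩? ∁? Q?) xs
count-split P? Q? [] = refl
count-split P? Q? (x ∷ xs) with P? x | Q? x
... | yes _ | yes _ = cong suc (count-split P? Q? xs)
... | yes _ | no _  = trans (cong suc (count-split P? Q? xs)) (sym (+-suc _ _))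
... | no _  | yes _ = count-split P? Q? xs
... | no _  | no _  = count-split P? Q? xs

length-split : {P : Pred A 0ℓ} (P? : Decidable P) → ∀ xs → length xs ≡ count P? xs + count (∁? P?) xs
length-split P? [] = refl
length-split P? (x ∷ xs) with P? x
... | yes _ = cong suc (length-split P? xs)
... | no _  = trans (cong suc (length-split P? xs)) (sym (+-suc _ _))

-- Induction on the list of bad events: those satisfying `E w` are split off, and `R` is
-- strengthened by the failure of `E w` for the rest. The factor `m` expresses that each event has
-- at most `N / m` elements without dividing.
union-bound : {R P : Pred A 0ℓ} {E : W → Pred A 0ℓ} (R? : Decidable R) (P? : Decidable P)
              (E? : ∀ w → Decidable (E w)) (xs : List A) (ws : List W) (m N : ℕ) →
              (∀ x → R x → (∀ {w} → w ∈ ws → ¬ E w x) → P x) →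
              (∀ {w} → w ∈ ws → m * count (R? ∩? E? w) xs ≤ N) →
              m * count R? xs ≤ m * count P? xs + length ws * N
union-bound R? P? E? xs [] m N avoid bound = begin
  m * count R? xs     ≤⟨ *-monoʳ-≤ m (count-mono R? P? (λ r → avoid _ r λ ()) xs) ⟩
  m * count P? xs     ≡⟨ +-identityʳ _ ⟨
  m * count P? xs + 0 ∎
  where open ≤-Reasoning
union-bound {R = R} {P} {E} R? P? E? xs (w ∷ ws) m N avoid bound = begin
  m * count R? xs
    ≡⟨ cong (m *_) (count-split R? (E? w) xs) ⟩
  m * (count (R? ∩? E? w) xs + count R′? xs)
    ≡⟨ *-distribˡ-+ m (count (R? ∩? E? w) xs) _ ⟩
  m * count (R? ∩? E? w) xs + m * count R′? xs
    ≤⟨ +-mono-≤ (bound (here refl)) (union-bound R′? P? E? xs ws m N avoid′ bound′) ⟩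
  N + (m * count P? xs + length ws * N)
    ≡⟨ +-assoc N (m * count P? xs) _ ⟨
  N + m * count P? xs + length ws * N
    ≡⟨ cong (_+ length ws * N) (+-comm N _) ⟩
  m * count P? xs + N + length ws * N
    ≡⟨ +-assoc (m * count P? xs) N _ ⟩
  m * count P? xs + (N + length ws * N) ∎
  where
  open ≤-Reasoning
  R′? = R? ∩? ∁? (E? w)

  avoid′ : ∀ x → R x × ¬ E w x → (∀ {w′} → w′ ∈ ws → ¬ E w′ x) → P x
  avoid′ x (r , ¬e) rest = avoid x r λ { (here refl) → ¬e ; (there w′∈ws) → rest w′∈ws }

  bound′ : ∀ {w′} → w′ ∈ ws → m * count (R′? ∩? E? w′) xs ≤ N
  bound′ {w′} w′∈ws = ≤-trans
    (*-monoʳ-≤ m (count-mono (R′? ∩? E? w′) (R? ∩? E? w′) (λ ((r , _) , e) → r , e) xs))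
    (bound (there w′∈ws))

length-cartesianProductWith : {B C : Set} (f : A → B → C) (xs : List A) (ys : List B) →
                              length (cartesianProductWith f xs ys) ≡ length xs * length ys
length-cartesianProductWith f []       ys = refl
length-cartesianProductWith f (x ∷ xs) ys = trans (length-++ (map (f x) ys))
  (cong₂ _+_ (length-map (f x) ys) (length-cartesianProductWith f xs ys))

length-concatMap≤ : {B : Set} (f : A → List B) → (∀ x → length (f x) ≤ m) →
                    ∀ xs → length (concatMap f xs) ≤ length xs * m
length-concatMap≤ f bound []       = z≤n
length-concatMap≤ f bound (x ∷ xs) = ≤-trans (≤-reflexive (length-++ (f x)))
  (+-mono-≤ (bound x) (length-concatMap≤ f bound xs))

-- Enumeration of all colourings, and the proportion in which two vertices agree.

colourings : ∀ n → List (Vec (Fin k) n)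
colourings zero    = [] ∷ []
colourings (suc n) = cartesianProductWith _∷_ (allFin _) (colourings n)

colourings-unique : ∀ n → Unique (colourings {k} n)
colourings-unique zero    = [] ∷ []
colourings-unique (suc n) = cartesianProductWith⁺ _∷_ ∷-injective (allFin⁺ _) (colourings-unique n)

colourings-complete : (f : Vec (Fin k) n) → f ∈ colourings n
colourings-complete []      = here refl
colourings-complete (c ∷ f) = ∈-cartesianProductWith⁺ _∷_ (∈-allFin c) (colourings-complete f)

-- One implication suffices: restoring the old colour of `v` gives the converse.
Ignores : Fin n → Pred (Vec (Fin k) n) 0ℓ → Set
Ignores v P = ∀ f c → P f → P (f [ v ]≔ c)

-- Recolouring v freely maps the pairs of a counted colouring and a colour onto the colourings satisfying P.
count-coincidence : {P : Pred (Vec (Fin k) n) 0ℓ} (P? : Decidable P) {u v : Fin n} → Ignores v P → u ≢ v →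
                    k * count (P? ∩? λ f → f ! v Fin.≟ f ! u) (colourings n) ≤ count P? (colourings n)
count-coincidence {k} {n} P? {u} {v} ignores u≢v = begin
  k * length hits                        ≡⟨ *-comm k _ ⟩
  length hits * k                        ≡⟨ cong (length hits *_) (length-tabulate {n = k} id) ⟨
  length hits * length (allFin k)        ≡⟨ length-cartesianProductWith _,_ hits (allFin k) ⟨
  length (cartesianProduct hits (allFin k))
    ≤⟨ Unique∧⊆⇒length≤ (cartesianProductWith⁺ _,_ (λ { refl → refl , refl })
         (filter⁺ _ (colourings-unique n)) (allFin⁺ k)) covered ⟩
  length (map g (filter P? (colourings n))) ≡⟨ length-map g (filter P? (colourings n)) ⟩
  count P? (colourings n) ∎
  where
  open ≤-Reasoning
  hits = filter (P? ∩? λ f → f ! v Fin.≟ f ! u) (colourings n)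

  -- `g` undoes a recolouring of `v`: where `v` used to agree with `u`, its old colour can be read
  -- off at `u`, and the new colour is still visible at `v`.
  g : Vec (Fin k) n → Vec (Fin k) n × Fin k
  g h = h [ v ]≔ (h ! u) , h ! v

  g-section : ∀ f c → f ! v ≡ f ! u → g (f [ v ]≔ c) ≡ (f , c)
  g-section f c eq = cong₂ _,_
    (trans ([]≔-idempotent f v)
      (trans (cong (f [ v ]≔_) (trans (lookup∘update′ u≢v f c) (sym eq))) ([]≔-lookup f v)))
    (lookup∘update v f c)

  covered : ∀ {x} → x ∈ cartesianProduct hits (allFin k) → x ∈ map g (filter P? (colourings n))
  covered {f , c} fc∈ with ∈-cartesianProduct⁻ hits (allFin k) fc∈
  ... | f∈ , _ with ∈-filter⁻ (P? ∩? λ f → f ! v Fin.≟ f ! u) {xs = colourings n} f∈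
  ...   | _ , p , eq = subst (_∈ map g (filter P? (colourings n))) (g-section f c eq)
            (∈-map⁺ g (∈-filter⁺ P? (colourings-complete _) (ignores f c p)))

-- Ramsey's theorem with an exponential bound.

ramsey : {R : Rel A 0ℓ} (R? : Decidable₂ R) → ∀ s w xs → length xs < suc w ^ s
         ⊎ (∃ λ ys → ys ⊑ xs × AllPairs R ys × length ys ≡ suc w)
         ⊎ (∃ λ ys → ys ⊑ xs × AllPairs (λ x y → ¬ R x y) ys × length ys ≡ suc s)
ramsey R? s w [] = inj₁ (m^n>0 (suc w) s)
ramsey R? zero w (x ∷ xs) = inj₂ (inj₂ (_ , refl ⊑∷ minimum xs , [] ∷ [] , refl))
ramsey R? (suc s) zero (x ∷ xs) = inj₂ (inj₁ (_ , refl ⊑∷ minimum xs , [] ∷ [] , refl))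
-- The vertex `x` extends any clique among the later vertices related to it and any independent set
-- among the others, so one target size drops by one in each half.
ramsey {A} {R} R? (suc s) (suc w) (x ∷ xs)
  with ramsey R? (suc s) w (filter (R? x) xs) | ramsey R? s (suc w) (filter (∁? (R? x)) xs)
... | inj₂ (inj₁ (ys , ys⊑ , pairs , len)) | _ = inj₂ (inj₁
  ( x ∷ ys , refl ⊑∷ ⊆-trans ys⊑ (filter-⊆ (R? x) xs)
  , All-resp-⊆ ys⊑ (all-filter (R? x) xs) ∷ pairs , cong suc len))
... | inj₂ (inj₂ (ys , ys⊑ , pairs , len)) | _ = inj₂ (inj₂
  (ys , x ∷ʳ ⊆-trans ys⊑ (filter-⊆ (R? x) xs) , pairs , len))
... | inj₁ _ | inj₂ (inj₁ (ys , ys⊑ , pairs , len)) = inj₂ (inj₁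
  (ys , x ∷ʳ ⊆-trans ys⊑ (filter-⊆ (∁? (R? x)) xs) , pairs , len))
... | inj₁ _ | inj₂ (inj₂ (ys , ys⊑ , pairs , len)) = inj₂ (inj₂
  ( x ∷ ys , refl ⊑∷ ⊆-trans ys⊑ (filter-⊆ (∁? (R? x)) xs)
  , All-resp-⊆ ys⊑ (all-filter (∁? (R? x)) xs) ∷ pairs , cong suc len))
... | inj₁ a< | inj₁ b< = inj₁ (begin
  suc (suc (length xs))                                     ≡⟨ cong (2 +_) (length-split (R? x) xs) ⟩
  suc (suc (a + b))                                         ≡⟨ cong suc (+-suc a b) ⟨
  suc a + suc b                                             ≤⟨ +-mono-≤ a< b< ⟩
  -- Enlarging the base of the first power makes the two terms add up to `suc (suc w)` copies of
  -- `suc (suc w) ^ s`.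
  suc w * suc w ^ s + suc (suc w) ^ s                       ≤⟨ +-monoˡ-≤ _ (*-monoʳ-≤ (suc w) (^-monoˡ-≤ s (n≤1+n (suc w)))) ⟩
  suc w * suc (suc w) ^ s + suc (suc w) ^ s                 ≡⟨ +-comm (suc w * suc (suc w) ^ s) _ ⟩
  suc (suc w) ^ suc s                                       ∎)
  where
  open ≤-Reasoning
  a = count (R? x) xs
  b = count (∁? (R? x)) xs

-- Approximate integer square roots and auxiliary facts.

sqrt-bounds : ∀ x → ∃ λ s → x ≤ s * s × s * s ≤ 4 * x
sqrt-bounds zero = zero , z≤n , z≤n
sqrt-bounds (suc x) with sqrt-bounds x
... | s , x≤s² , s²≤4x with suc x ≤? s * s
...   | yes x<s² = s , x<s² , ≤-trans s²≤4x (*-monoʳ-≤ 4 (n≤1+n x))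
...   | no x≮s² = suc s , lower , upper
  where
  open ≤-Reasoning

  -- The root is raised only when its square falls short of `suc x`. Then also `s ≤ x`, and the new
  -- square, `1 + 2 * s + s * s`, is at most `1 + 3 * x`.
  s²≤x : s * s ≤ x
  s²≤x = ≮⇒≥ x≮s²

  n≤n² : ∀ n → n ≤ n * n
  n≤n² zero    = z≤n
  n≤n² (suc n) = m≤m*n (suc n) (suc n)

  s≤x : s ≤ x
  s≤x = ≤-trans (n≤n² s) s²≤x

  lower : suc x ≤ suc s * suc s
  lower = s≤s (begin
    x             ≤⟨ x≤s² ⟩
    s * s         ≤⟨ *-monoʳ-≤ s (n≤1+n s) ⟩
    s * suc s     ≤⟨ m≤n+m _ s ⟩
    s + s * suc s ∎)

  upper : suc s * suc s ≤ 4 * suc x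
  upper = +-mono-≤ (s≤s s≤x) (begin
    s * suc s     ≡⟨ *-suc s s ⟩
    s + s * s     ≤⟨ +-mono-≤ (m≤n⇒m≤1+n s≤x) (m≤n⇒m≤1+n s²≤x) ⟩
    suc x + suc x ≤⟨ +-monoʳ-≤ (suc x) (m≤m+n (suc x) _) ⟩
    3 * suc x     ∎)

x∉p-x : ∀ {n} (p : Subset n) x → x ∉ₛ p - x
x∉p-x (_ ∷ p) zero    ()
x∉p-x (_ ∷ p) (suc x) (Vec.there x∈) = x∉p-x p x x∈

any-member : {A : Set} {xs : List A} → 0 < length xs → ∃ (_∈ xs)
any-member {xs = x ∷ xs} _ = x , here refl

∈-concatMap : {A B : Set} (f : A → List B) {xs : List A} {x : A} {y : B} →
              x ∈ xs → y ∈ f x → y ∈ concatMap f xs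
∈-concatMap f x∈xs y∈fx = ∈-concatMap⁺ f (lose x∈xs y∈fx)

-- Clears the scale from a union bound: at most `c * s` events, each of proportion at most
-- `1 / (4 * s)` of `N`, cost at most `c` quarters of `N`.
cancel-scale : ∀ s .{{_ : NonZero s}} c {l L M N} → 4 * s * L ≤ 4 * s * M + l * N → l ≤ c * s →
               4 * L ≤ 4 * M + c * N
cancel-scale s c {l} {L} {M} {N} le l≤cs = *-cancelˡ-≤ s (begin
  s * (4 * L)                 ≡⟨ solve 2 (λ s L → s :* (con 4 :* L) := con 4 :* s :* L) refl s L ⟩
  4 * s * L                   ≤⟨ le ⟩
  4 * s * M + l * N           ≤⟨ +-monoʳ-≤ (4 * s * M) (*-monoˡ-≤ N l≤cs) ⟩
  4 * s * M + c * s * N       ≡⟨ solve 4 (λ s c M N → con 4 :* s :* M :+ c :* s :* N :=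
                                                   s :* (con 4 :* M :+ c :* N)) refl s c M N ⟩
  s * (4 * M + c * N)         ∎)
  where
  open ≤-Reasoning
  open +-*-Solver

-- Colourings valid on a set of vertices.

module _ {n : ℕ} (G : Graph (Fin n)) where
  open Graph G

  neighbours : Fin n → List (Fin n)
  neighbours v = filter (v ~?_) (allFin n)

  ∈-neighbours : ∀ {u v} → v ~ u → u ∈ neighbours v
  ∈-neighbours v~u = ∈-filter⁺ (_ ~?_) (∈-allFin _) v~u

  ~⇒≢ : ∀ {u v} → u ~ v → u ≢ v
  ~⇒≢ u~v u≡v = ~-irrefl u≡v u~v

  -- The local form of the star forest condition. The alternatives `a ≡ c` and `b ≡ d` allow walks
  -- that double back; a closed walk with `a ≡ d` is a triangle, which properness keeps from being
  -- bicoloured.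
  NoBicolouredWalk : {C : Set} → (Fin n → Set) → (Fin n → C) → Set
  NoBicolouredWalk S f = ∀ a b c d → S a → S b → S c → S d →
    a ~ b → b ~ c → c ~ d → f a ≡ f c → f b ≡ f d → a ≡ c ⊎ b ≡ d

  Proper : {C : Set} → (Fin n → Set) → (Fin n → C) → Set
  Proper S f = ∀ a b → S a → S b → a ~ b → f a ≢ f b

  module _ {k : ℕ} where

    Colouring : Set
    Colouring = Vec (Fin k) n

    ProperOn Valid : Subset n → Pred Colouring 0ℓ
    ProperOn S f = Proper (_∈ₛ S) (f !_)
    Valid S f = ProperOn S f × NoBicolouredWalk (_∈ₛ S) (f !_)

    properOn? : ∀ S → Decidable (ProperOn S)
    properOn? S f = all? λ a → all? λ b → a ∈? S →-dec b ∈? S →-dec a ~? b →-dec ¬? (f ! a Fin.≟ f ! b)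

    valid? : ∀ S → Decidable (Valid S)
    valid? S f = properOn? S f ×-dec
      (all? λ a → all? λ b → all? λ c → all? λ d →
        a ∈? S →-dec b ∈? S →-dec c ∈? S →-dec d ∈? S →-dec
        a ~? b →-dec b ~? c →-dec c ~? d →-dec
        f ! a Fin.≟ f ! c →-dec f ! b Fin.≟ f ! d →-dec (a Fin.≟ c ⊎-dec b Fin.≟ d))

    valid-mono : ∀ {S T} → (∀ {x} → x ∈ₛ T → x ∈ₛ S) → ∀ f → Valid S f → Valid T f
    valid-mono T⊆S f (proper , walk) =
      (λ a b a∈ b∈ → proper a b (T⊆S a∈) (T⊆S b∈)) ,
      (λ a b c d a∈ b∈ c∈ d∈ → walk a b c d (T⊆S a∈) (T⊆S b∈) (T⊆S c∈) (T⊆S d∈))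

    valid-local : ∀ {S} f g → (∀ {x} → x ∈ₛ S → f ! x ≡ g ! x) → Valid S f → Valid S g
    valid-local f g f≗g (proper , walk) =
      (λ a b a∈ b∈ a~b ga≡gb → proper a b a∈ b∈ a~b (trans (f≗g a∈) (trans ga≡gb (sym (f≗g b∈))))) ,
      (λ a b c d a∈ b∈ c∈ d∈ ab bc cd ga≡gc gb≡gd → walk a b c d a∈ b∈ c∈ d∈ ab bc cd
        (trans (f≗g a∈) (trans ga≡gc (sym (f≗g c∈))))
        (trans (f≗g b∈) (trans gb≡gd (sym (f≗g d∈)))))

    valid-ignores : ∀ {S v} → v ∉ₛ S → Ignores v (Valid S)
    valid-ignores v∉S f c = valid-local f (f [ _ ]≔ c) λ x∈S →
      sym (lookup∘update′ (λ { refl → v∉S x∈S }) f c)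

    coincidence-ignores : ∀ {a q v : Fin n} → a ≢ v → q ≢ v → Ignores v (λ (f : Colouring) → f ! a ≡ f ! q)
    coincidence-ignores a≢v q≢v f c eq =
      trans (lookup∘update′ a≢v f c) (trans eq (sym (lookup∘update′ q≢v f c)))

  -- Walks through a vertex, and extending validity from `S - v` to `S`.

  paths : List (Fin n) → (Fin n → List (Fin n)) → List (Fin n × Fin n × Fin n)
  paths as next = concatMap (λ a → concatMap (λ b → map (λ c → a , b , c) (neighbours b)) (next a)) as

  ∈-paths : ∀ as next {a b c} → a ∈ as → b ∈ next a → b ~ c → (a , b , c) ∈ paths as next
  ∈-paths as next a∈ b∈ b~c = ∈-concatMap _ a∈ (∈-concatMap _ b∈ (∈-map⁺ _ (∈-neighbours b~c)))

  -- The triples (a , p , q) for which v ~ a ~ p ~ q or a ~ v ~ q ~ p: such a walk is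
  -- bicoloured when v agrees with p, and a with q.
  walks : Fin n → List (Fin n × Fin n × Fin n)
  walks v = paths (neighbours v) neighbours
         ++ map (λ (a , q , p) → a , p , q) (paths (neighbours v) (λ _ → neighbours v))

  -- What recolouring first `v` and then `a` requires: `a` can be deleted from `T`, the colours of
  -- `p` and `q` survive a change at `v`, and that of `q` survives a change at `a`.
  Relevant : Subset n → Fin n → Pred (Fin n × Fin n × Fin n) 0ℓ
  Relevant T v (a , p , q) = a ∈ₛ T × p ≢ v × q ≢ v × q ≢ a

  relevant? : ∀ T v → Decidable (Relevant T v)
  relevant? T v (a , p , q) = a ∈? T ×-dec ¬? (p Fin.≟ v) ×-dec ¬? (q Fin.≟ v) ×-dec ¬? (q Fin.≟ a)

  module _ {k : ℕ} where

    Bicoloured : Fin n → Fin n × Fin n × Fin n → Pred (Vec (Fin k) n) 0ℓ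
    Bicoloured v (a , p , q) f = f ! a ≡ f ! q × f ! v ≡ f ! p

    bicoloured? : ∀ v w → Decidable (Bicoloured v w)
    bicoloured? v (a , p , q) f = f ! a Fin.≟ f ! q ×-dec f ! v Fin.≟ f ! p

    extend-proper : ∀ {S v} (f : Vec (Fin k) n) → Valid (S - v) f →
                    (∀ {u} → u ∈ neighbours v → f ! v ≢ f ! u) → ProperOn S f
    extend-proper {S} {v} f (proper , _) avoid a b a∈ b∈ a~b with a Fin.≟ v | b Fin.≟ v
    ... | yes refl | _        = avoid (∈-neighbours a~b)
    ... | no _     | yes refl = avoid (∈-neighbours (~-sym a~b)) ∘ sym
    ... | no a≢v   | no b≢v   = proper a b (x∈p∧x≢y⇒x∈p-y a∈ a≢v) (x∈p∧x≢y⇒x∈p-y b∈ b≢v) a~b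

    -- A walk that is new in `S` passes through `v`; after reversal if necessary, `v` is its first
    -- or second vertex.
    extend-valid : ∀ {S v} (f : Vec (Fin k) n) → Valid (S - v) f → ProperOn S f →
                   (∀ {w} → w ∈ filter (relevant? (S - v) v) (walks v) → ¬ Bicoloured v w f) → Valid S f
    extend-valid {S} {v} f (_ , walk) proper avoid = proper , extended
      where
      within : ∀ {x} → x ∈ₛ S → x ≢ v → x ∈ₛ S - v
      within = x∈p∧x≢y⇒x∈p-y

      end : ∀ {b c d} → v ∈ₛ S → b ∈ₛ S → c ∈ₛ S → d ∈ₛ S → v ~ b → b ~ c → c ~ d →
            f ! v ≡ f ! c → f ! b ≡ f ! d → v ≡ c ⊎ b ≡ d
      end {b} {c} {d} v∈ b∈ c∈ d∈ vb bc cd v≈c b≈d with v Fin.≟ c | b Fin.≟ d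
      ... | yes v≡c | _       = inj₁ v≡c
      ... | no _    | yes b≡d = inj₂ b≡d
      ... | no v≢c  | no b≢d  = contradiction (b≈d , v≈c) (avoid (∈-filter⁺ (relevant? (S - v) v)
              (∈-++⁺ˡ (∈-paths (neighbours v) neighbours (∈-neighbours vb) (∈-neighbours bc) cd))
              ( within b∈ (~⇒≢ vb ∘ sym) , v≢c ∘ sym
              -- A walk returning to `v` would make `c` and `v` adjacent with equal colours. This is
              -- why properness on all of `S` is secured before walks are considered.
              , (λ { refl → proper c v c∈ v∈ cd (sym v≈c) }) , b≢d ∘ sym)))

      middle : ∀ {a c d} → v ∈ₛ S → a ∈ₛ S → c ∈ₛ S → d ∈ₛ S → a ~ v → v ~ c → c ~ d →
               f ! a ≡ f ! c → f ! v ≡ f ! d → a ≡ c ⊎ v ≡ d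
      middle {a} {c} {d} v∈ a∈ c∈ d∈ av vc cd a≈c v≈d with a Fin.≟ c | v Fin.≟ d
      ... | yes a≡c | _       = inj₁ a≡c
      ... | no _    | yes v≡d = inj₂ v≡d
      ... | no a≢c  | no v≢d  = contradiction (a≈c , v≈d) (avoid (∈-filter⁺ (relevant? (S - v) v)
              (∈-++⁺ʳ (paths (neighbours v) neighbours)
                (∈-map⁺ _ (∈-paths (neighbours v) (λ _ → neighbours v)
                  (∈-neighbours (~-sym av)) (∈-neighbours vc) cd)))
              (within a∈ (~⇒≢ av) , v≢d ∘ sym , ~⇒≢ vc ∘ sym , a≢c ∘ sym)))

      reverse : ∀ {a b c d : Fin n} → d ≡ b ⊎ c ≡ a → a ≡ c ⊎ b ≡ d
      reverse = Sum.swap ∘ Sum.map sym sym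

      extended : NoBicolouredWalk (_∈ₛ S) (f !_)
      extended a b c d a∈ b∈ c∈ d∈ ab bc cd a≈c b≈d
        with a Fin.≟ v | b Fin.≟ v | c Fin.≟ v | d Fin.≟ v
      ... | yes refl | _ | _ | _ = end a∈ b∈ c∈ d∈ ab bc cd a≈c b≈d
      ... | no _ | yes refl | _ | _ = middle b∈ a∈ c∈ d∈ ab bc cd a≈c b≈d
      ... | no _ | no _ | yes refl | _ =
              reverse (middle c∈ d∈ b∈ a∈ (~-sym cd) (~-sym bc) (~-sym ab) (sym b≈d) (sym a≈c))
      ... | no _ | no _ | no _ | yes refl =
              reverse (end d∈ c∈ b∈ a∈ (~-sym cd) (~-sym bc) (~-sym ab) (sym b≈d) (sym a≈c))
      ... | no a≢v | no b≢v | no c≢v | no d≢v =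
              walk a b c d (within a∈ a≢v) (within b∈ b≢v) (within c∈ c≢v) (within d∈ d≢v) ab bc cd a≈c b≈d

  -- From the absence of bicoloured walks to star forests.

  isStarColouring : ∀ {k} (f : Fin n → Fin k) → (∀ {a b} → a ~ b → f a ≢ f b) →
    (∀ {a b c d} → a ~ b → b ~ c → c ~ d → f a ≡ f c → f b ≡ f d → a ≡ c ⊎ b ≡ d) → IsStarColouring G f
  isStarColouring {k} f proper walk = record { proper = proper ; starForest = λ {i} {j} _ → forest i j }
    where
    module _ (i j : Fin k) where
      InClasses : Pred (Fin n) 0ℓ
      InClasses x = f x ≡ i ⊎ f x ≡ j

      inClasses? : Decidable InClasses
      inClasses? x = f x Fin.≟ i ⊎-dec f x Fin.≟ j

      -- Properness makes the colours alternate along a walk inside two classes, so every walk of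
      -- length three there is bicoloured and has to double back.
      same : ∀ {a b c} → InClasses a → InClasses b → InClasses c → a ~ b → b ~ c → f a ≡ f c
      same (inj₁ a) (inj₁ b) _        ab bc = contradiction (trans a (sym b)) (proper ab)
      same (inj₁ a) (inj₂ b) (inj₁ c) ab bc = trans a (sym c)
      same (inj₁ a) (inj₂ b) (inj₂ c) ab bc = contradiction (trans b (sym c)) (proper bc)
      same (inj₂ a) (inj₁ b) (inj₁ c) ab bc = contradiction (trans b (sym c)) (proper bc)
      same (inj₂ a) (inj₁ b) (inj₂ c) ab bc = trans a (sym c)
      same (inj₂ a) (inj₂ b) _        ab bc = contradiction (trans a (sym b)) (proper ab)

      -- The centre is a neighbour u of v with a further neighbour w in the two classes, or v if there is none.
      forest : IsStarForest (induced G InClasses)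
      forest (v , [ v∈ ]) with any? (λ u → any? λ w →
        inClasses? u ×-dec inClasses? w ×-dec v ~? u ×-dec u ~? w ×-dec ¬? (w Fin.≟ v))
      ... | no ¬∃ = ExhaustiveSearch.Components.component (induced G InClasses)
        ( inj₁ refl
        , λ (u , [ u∈ ]) vu (w , [ w∈ ]) uw → value-injective (recompute (w Fin.≟ v)
            (decidable-stable (w Fin.≟ v) λ w≢v → ¬∃ (u , w , u∈ , w∈ , vu , uw , w≢v))))
      ... | yes (u , w , u∈ , w∈ , vu , uw , w≢v) =
        ExhaustiveSearch.Components.component (induced G InClasses) {c = u , [ u∈ ]}
        ( inj₂ vu
        , λ (y , [ y∈ ]) uy (z , [ z∈ ]) yz → value-injective (recompute (z Fin.≟ u) (back v∈ y∈ z∈ uy yz)))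
        where
        back : ∀ {y z} → InClasses v → InClasses y → InClasses z → u ~ y → y ~ z → z ≡ u
        -- The walk `z`, `y`, `u` is continued to `v`, or to `w` when `y` is `v`. Its last vertex
        -- then differs from `y`, which forces `z ≡ u`.
        back {y} v∈ y∈ z∈ uy yz with y Fin.≟ v
        ... | no y≢v = Sum.[ id , (λ y≡v → contradiction y≡v y≢v) ]
              (walk (~-sym yz) (~-sym uy) (~-sym vu) (same z∈ y∈ u∈ (~-sym yz) (~-sym uy))
                (same y∈ u∈ v∈ (~-sym uy) (~-sym vu)))
        ... | yes y≡v = Sum.[ id , (λ y≡w → contradiction (trans (sym y≡w) y≡v) w≢v) ]
              (walk (~-sym yz) (~-sym uy) uw (same z∈ y∈ u∈ (~-sym yz) (~-sym uy))
                (same y∈ u∈ w∈ (~-sym uy) uw))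

  -- Rosenfeld's count with `4 * s` colours for maximum degree at most `D`.

  module _ {D s : ℕ} .{{s≢0 : NonZero s}} (degree : ∀ v → length (neighbours v) ≤ D)
           (D≤s : D ≤ s) (D³≤s² : D * (D * D) ≤ s * s) where

    private
      K : ℕ
      K = 4 * s

      instance
        s²≢0 : NonZero (s * s)
        s²≢0 = m*n≢0 s s

    #_ : {P : Pred (Vec (Fin K) n) 0ℓ} → Decidable P → ℕ
    # P? = count P? (colourings n)

    length-paths : ∀ as next → length as ≤ D → (∀ a → length (next a) ≤ D) → length (paths as next) ≤ s * s
    length-paths as next as≤ next≤ = begin
      length (paths as next) ≤⟨ length-concatMap≤ _ (λ a → ≤-trans
                                  (length-concatMap≤ _ (λ b → ≤-trans
                                    (≤-reflexive (length-map _ (neighbours b))) (degree b)) (next a))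
                                  (*-monoˡ-≤ D (next≤ a))) as ⟩
      length as * (D * D)    ≤⟨ *-monoˡ-≤ (D * D) as≤ ⟩
      D * (D * D)            ≤⟨ D³≤s² ⟩
      s * s                  ∎
      where open ≤-Reasoning

    length-walks : ∀ v → length (walks v) ≤ 2 * (s * s)
    length-walks v = begin
      length (walks v)                ≡⟨ length-++ ends ⟩
      length ends + length (map _ middles) ≡⟨ cong (length ends +_) (length-map _ middles) ⟩
      length ends + length middles    ≤⟨ +-mono-≤
        (length-paths (neighbours v) neighbours (degree v) degree)
        (length-paths (neighbours v) (λ _ → neighbours v) (degree v) (λ _ → degree v)) ⟩
      s * s + s * s                   ≡⟨ cong (s * s +_) (+-identityʳ (s * s)) ⟨
      2 * (s * s)                     ∎
      where
      open ≤-Reasoning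
      ends    = paths (neighbours v) neighbours
      middles = paths (neighbours v) (λ _ → neighbours v)

    -- In units of a quarter of `N`, the neighbours of `v` cost one (`step₁`, by `D ≤ s`) and the
    -- walks through `v` cost two (`step₂`, by the bound on `D * (D * D)`), which leaves one.
    valid-shrink : ∀ S → Acc _⊂_ S → ∀ {v} → v ∈ₛ S → # valid? (S - v) ≤ 4 * # valid? S
    valid-shrink S (acc rs) {v} v∈S = +-cancelʳ-≤ (3 * N) N (4 * N′) (begin
      4 * N                     ≤⟨ step₁ ⟩
      4 * M + 1 * N             ≤⟨ +-monoˡ-≤ (1 * N) step₂ ⟩
      4 * N′ + 2 * N + 1 * N    ≡⟨ solve 2 (λ N N′ → con 4 :* N′ :+ con 2 :* N :+ con 1 :* N :=
                                                     con 4 :* N′ :+ con 3 :* N) refl N N′ ⟩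
      4 * N′ + 3 * N            ∎)
      where
      open ≤-Reasoning
      open +-*-Solver
      T = S - v
      semi? = valid? T ∩? properOn? S
      N N′ M : ℕ
      N = # valid? T
      N′ = # valid? S
      M = # semi?

      v∉T : v ∉ₛ T
      v∉T = x∉p-x S v

      step₁ : 4 * N ≤ 4 * M + 1 * N
      step₁ = cancel-scale s 1
        (union-bound (valid? T) semi? (λ u f → f ! v Fin.≟ f ! u) (colourings n) (neighbours v) K N
          (λ f valid avoid → valid , extend-proper f valid avoid)
          (λ u∈ → count-coincidence (valid? T) (valid-ignores v∉T)
                    (~⇒≢ (proj₂ (∈-filter⁻ (v ~?_) {xs = allFin n} u∈)) ∘ sym)))
        (≤-trans (degree v) (≤-trans D≤s (≤-reflexive (sym (+-identityʳ s)))))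

      walk-bound : ∀ {w} → Relevant T v w → 4 * (s * s) * # (semi? ∩? bicoloured? v w) ≤ N
      -- Weakening validity from `T` to `T - a` frees the colours of both `v` and `a`, so each of
      -- the two coincidences gains a factor `K`. The induction hypothesis for `T` returns from
      -- `T - a` to `T` at the price of the factor 4 cancelled here.
      walk-bound {a , p , q} (a∈T , p≢v , q≢v , q≢a) = *-cancelˡ-≤ 4 (begin
        4 * (4 * (s * s) * # (semi? ∩? bicoloured? v (a , p , q)))
          ≡⟨ solve 2 (λ s B → con 4 :* (con 4 :* (s :* s) :* B) := con 4 :* s :* (con 4 :* s :* B)) refl s _ ⟩
        K * (K * # (semi? ∩? bicoloured? v (a , p , q)))
          ≤⟨ *-monoʳ-≤ K (*-monoʳ-≤ K (count-mono
               (semi? ∩? bicoloured? v (a , p , q)) (agree? ∩? λ f → f ! v Fin.≟ f ! p)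
               (λ {f} ((valid , _) , aq , vp) → (valid-mono (p─q⊆p T _) f valid , aq) , vp) (colourings n))) ⟩
        K * (K * # (agree? ∩? λ f → f ! v Fin.≟ f ! p))
          ≤⟨ *-monoʳ-≤ K (count-coincidence agree?
               (λ f c (valid , aq) → valid-ignores (v∉T ∘ p─q⊆p T _) f c valid ,
                 coincidence-ignores (λ { refl → v∉T a∈T }) q≢v f c aq) p≢v) ⟩
        K * # agree?
          ≤⟨ count-coincidence (valid? (T - a)) (valid-ignores (x∉p-x T a)) q≢a ⟩
        # valid? (T - a)
          ≤⟨ valid-shrink T (rs (x∈p⇒p-x⊂p v∈S)) a∈T ⟩
        4 * N ∎)
        where
        agree? = valid? (T - a) ∩? λ f → f ! a Fin.≟ f ! q

      step₂ : 4 * M ≤ 4 * N′ + 2 * N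
      step₂ = cancel-scale (s * s) 2
        (union-bound semi? (valid? S) (bicoloured? v) (colourings n) ws (4 * (s * s)) N
          (λ f (valid , proper) → extend-valid f valid proper)
          (λ w∈ → walk-bound (proj₂ (∈-filter⁻ (relevant? T v) {xs = walks v} w∈))))
        (≤-trans (length-filter (relevant? T v) (walks v)) (length-walks v))
        where
        ws = filter (relevant? T v) (walks v)

    -- By `valid-shrink`, a zero count for `S` would give one for `S - v`. On the empty set every
    -- colouring is valid, so a constant one serves.
    valid-exists : ∀ S → Acc _⊂_ S → 0 < # valid? S
    valid-exists S (acc rs) with nonempty? S
    ... | yes (v , v∈S) = n≢0⇒n>0 λ #S≡0 → n>0⇒n≢0 (valid-exists (S - v) (rs (x∈p⇒p-x⊂p v∈S)))
            (n≤0⇒n≡0 (≤-trans (valid-shrink S (⊂-wellFounded S) v∈S) (≤-reflexive (cong (4 *_) #S≡0))))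
    ... | no empty = ∈-length (∈-filter⁺ (valid? S) (colourings-complete (replicate n colour₀))
            ((λ a _ a∈ → contradiction (a , a∈) empty) , (λ a _ _ _ a∈ → contradiction (a , a∈) empty)))
      where
      colour₀ : Fin K
      colour₀ = fromℕ< {0} (>-nonZero⁻¹ K {{m*n≢0 4 s}})

    starColourable : StarColourable G K
    starColourable with any-member (valid-exists ⊤ (⊂-wellFounded ⊤))
    ... | f , f∈ with ∈-filter⁻ (valid? ⊤) {xs = colourings n} f∈
    ...   | _ , proper , walk = (f !_) , isStarColouring (f !_)
              (λ {a} {b} → proper a b ∈⊤ ∈⊤) (λ {a} {b} {c} {d} → walk a b c d ∈⊤ ∈⊤ ∈⊤ ∈⊤)

-- Ramsey's theorem in the neighbourhoods of a star-free graph.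

module _ {n : ℕ} (G : Graph (Fin n)) where
  open Graph G

  clique-embedding : ∀ {xs} → AllPairs _~_ xs → complete (length xs) ↪ G
  clique-embedding {xs} pairs = record
    { to        = lookup xs
    ; injective = λ {i} {j} eq → decidable-stable (i Fin.≟ j) λ i≢j → ~-irrefl eq (adjacent i≢j)
    ; adjacency = mk⇔ adjacent λ e i≡j → ~-irrefl (cong (lookup xs) i≡j) e
    }
    where
    adjacent : ∀ {i j} → i ≢ j → lookup xs i ~ lookup xs j
    adjacent = AllPairs-lookup ~-sym pairs

  star-embedding : ∀ {v xs} → All (v ~_) xs → Unique xs → AllPairs (λ x y → ¬ x ~ y) xs → star (length xs) ↪ G
  star-embedding {v} {xs} spokes unique independent = record
    { to        = to
    ; injective = injective
    ; adjacency = mk⇔ adjacent reflects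
    }
    where
    to : Fin (suc (length xs)) → Fin n
    to zero    = v
    to (suc i) = lookup xs i

    spoke : ∀ i → v ~ lookup xs i
    spoke i = All.lookup spokes (∈-lookup i)

    injective : ∀ {i j} → to i ≡ to j → i ≡ j
    injective {zero}  {zero}  eq = refl
    injective {zero}  {suc j} eq = contradiction (spoke j) (~-irrefl eq)
    injective {suc i} {zero}  eq = contradiction (spoke i) (~-irrefl (sym eq))
    injective {suc i} {suc j} eq = cong suc
      (decidable-stable (i Fin.≟ j) λ i≢j → AllPairs-lookup ≢-sym unique i≢j eq)

    adjacent : ∀ {i j} → StarAdj i j → to i ~ to j
    adjacent (centre-leaf {i}) = spoke i
    adjacent (leaf-centre {i}) = ~-sym (spoke i)

    reflects : ∀ {i j} → to i ~ to j → StarAdj i j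
    reflects {zero}  {zero}  e = contradiction e (~-irrefl refl)
    reflects {zero}  {suc j} e = centre-leaf
    reflects {suc i} {zero}  e = leaf-centre
    reflects {suc i} {suc j} e with i Fin.≟ j
    ... | yes refl = contradiction e (~-irrefl refl)
    ... | no i≢j   = contradiction e (AllPairs-lookup (λ ¬e → ¬e ∘ ~-sym) independent i≢j)

  -- Together with `v`, a clique of size `suc w` among its neighbours has size `2 + w`, and an
  -- independent set of size `suc r` forms an induced star.
  degree-bound : ∀ {r w} → ¬ (star (suc r) ↪ G) → ¬ (complete (2 + w) ↪ G) →
                 ∀ v → length (neighbours G v) < suc w ^ r
  degree-bound {r} {w} no-star no-clique v with ramsey _~?_ r w (neighbours G v)
  ... | inj₁ small = small
  ... | inj₂ (inj₁ (ys , ys⊑ , pairs , len)) = contradiction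
    (subst (λ m → complete (suc m) ↪ G) len
      (clique-embedding (All-resp-⊆ ys⊑ (all-filter (v ~?_) (allFin n)) ∷ pairs)))
    no-clique
  ... | inj₂ (inj₂ (ys , ys⊑ , pairs , len)) = contradiction
    (subst (λ m → star m ↪ G) len
      (star-embedding (All-resp-⊆ ys⊑ (all-filter (v ~?_) (allFin n)))
        (AllPairs-resp-⊑ ys⊑ (filter⁺ (v ~?_) (allFin⁺ n))) pairs))
    no-star

-- The bound on the star chromatic number.

square-cancel-≤ : ∀ {m n} → m * m ≤ n * n → m ≤ n
square-cancel-≤ m²≤n² = ≮⇒≥ λ n<m → <⇒≱ (*-mono-< n<m n<m) m²≤n²

-- Squaring keeps the half-integral exponent within ℕ. The constant is `8 ^ 2 = 16 * 4`: the 16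
-- comes from squaring `4 * s`, the 4 from rounding the square root of `D * (D * D)`.
colouring-bound : ∀ r {n} .{{_ : NonZero n}} (G : Graph (Fin n)) → ¬ (star (suc r) ↪ G) →
                  ∀ {ω χ} → IsCliqueNumber G ω → IsStarChromaticNumber G χ → χ ^ 2 ≤ 8 ^ 2 * ω ^ (3 * r)
-- A nonempty graph has a clique of size one, so its clique number is positive.
colouring-bound r {suc n} G free {zero} (_ , maximal) _ =
  contradiction (maximal (clique-embedding G {zero ∷ []} ([] ∷ []))) λ ()
colouring-bound r {suc n} G free {suc w} {χ} (_ , maximal) (_ , minimal) with sqrt-bounds (D * (D * D))
  where
  D = suc w ^ r
... | s , D³≤s² , s²≤4D³ = begin
  χ ^ 2                      ≤⟨ ^-monoˡ-≤ 2 (minimal (starColourable G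
                                  (λ v → <⇒≤ (degree-bound G free (λ K → 1+n≰n (maximal K)) v)) D≤s D³≤s²)) ⟩
  (4 * s) ^ 2                ≡⟨ solve 1 (λ s → (con 4 :* s) :^ 2 := con 16 :* (s :* s)) refl s ⟩
  16 * (s * s)               ≤⟨ *-monoʳ-≤ 16 s²≤4D³ ⟩
  16 * (4 * (D * (D * D)))   ≡⟨ *-assoc 16 4 (D * (D * D)) ⟨
  64 * (D * (D * D))         ≡⟨ cong (64 *_) D³ ⟩
  64 * suc w ^ (3 * r)       ∎
  where
  open ≤-Reasoning
  open +-*-Solver

  D = suc w ^ r

  instance
    D≢0 : NonZero D
    D≢0 = m^n≢0 (suc w) r

  D≤s : D ≤ s
  -- As `D` is positive, its square is at most its cube.
  D≤s = square-cancel-≤ (≤-trans (m≤n*m (D * D) D) D³≤s²)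

  instance
    s≢0 : NonZero s
    s≢0 = >-nonZero (≤-trans (m^n>0 (suc w) r) D≤s)

  D³ : D * (D * D) ≡ suc w ^ (3 * r)
  D³ = begin-equality
    D * (D * D)                ≡⟨ solve 1 (λ D → D :* (D :* D) := D :^ 3) refl D ⟩
    D ^ 3                      ≡⟨ ^-*-assoc (suc w) r 3 ⟩
    suc w ^ (r * 3)            ≡⟨ cong (suc w ^_) (*-comm r 3) ⟩
    suc w ^ (3 * r)            ∎

theorem4 : (t : ℕ) .{{_ : NonZero t}} →
    PolynomiallyχₛBounded (StarFree t) ×
    Σ ℕ (λ c → {n : ℕ} .{{_ : NonZero n}} (G : Graph (Fin n)) →
    HereditaryClass.Member (StarFree t) G →
    χₛ G ^ 2 ≤ c ^ 2 * ω G ^ (3 * (t ∸ 1)))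
theorem4 (suc r) = (polynomial , (64 , 3 * r , λ x → ≤-refl) , polynomial-bound) , 8 , square-bound
  where
  polynomial : ℕ → ℕ
  -- Since `χₛ G ≤ χₛ G ^ 2`, the bound on the square serves directly as the polynomial.
  polynomial x = 64 * x ^ (3 * r) + 64

  square-bound : ∀ {n} .{{_ : NonZero n}} (G : Graph (Fin n)) → ¬ (star (suc r) ↪ G) →
                 χₛ G ^ 2 ≤ 8 ^ 2 * ω G ^ (3 * r)
  square-bound G free = colouring-bound r G free (proj₂ (cliqueNumber G)) (proj₂ (starChromaticNumber G))

  n≤n^2 : ∀ n → n ≤ n ^ 2
  n≤n^2 zero    = z≤n
  n≤n^2 (suc n) = m≤m*n (suc n) (suc n ^ 1) {{m^n≢0 (suc n) 1}}

  polynomial-bound : ∀ {n} (G : Graph (Fin n)) → ¬ (star (suc r) ↪ G) → χₛ G ≤ polynomial (ω G)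
  -- The rainbow colouring of the empty graph uses no colours.
  polynomial-bound {zero}  G free = ≤-trans (proj₂ (proj₂ (starChromaticNumber G)) (ExhaustiveSearch.rainbow G)) z≤n
  polynomial-bound {suc n} G free = ≤-trans (n≤n^2 (χₛ G)) (≤-trans (square-bound G free) (m≤m+n _ 64))
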